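{- Let $p>1$ be an integer and let $u^{(p)}=\lim_{n\to\infty}\varphi_p^n(L)$ be the fixed point of the substitution $\varphi_p$ on $\{L,S,M\}$ given by $\varphi_p(L)=L^pS$, $\varphi_p(S)=M$, $\varphi_p(M)=L^{p-1}S$. Then $u^{(p)}$ is $3$-balanced with respect to the letter $L$, $2$-balanced with respect to the letter $S$, and $2$-balanced with respect to the letter $M$, and none of these bounds can be improved; that is, there exist factors $v,w$ of $u^{(p)}$ with $|v|=|w|$ and $\bigl||v|_L-|w|_L\bigr|=3$, factors with $|v|=|w|$ and $\bigl||v|_S-|w|_S\bigr|=2$, and factors with $|v|=|w|$ and $\bigl||v|_M-|w|_M\bigr|=2$.
   Context: For a finite word $w$, $|w|$ denotes its length and $|w|_a$ the number of occurrences of the letter $a$ in $w$. A factor of an infinite word $u$ is a finite contiguous block of $u$. An infinite word $u$ over an alphabet $\mathcal A$ is $c$-balanced with respect to the letter $a\in\mathcal A$ if $\bigl||v|_a-|w|_a\bigr|\le c$ for all pairs of factors $v,w$ of $u$ with $|v|=|w|$. The substitution $\varphi_p$ is extended to words by concatenation; $u^{(p)}$ is its unique fixed point starting with $L$. -}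

module Defs where

open import Data.Nat using (ℕ; zero; suc; _+_; _∸_; _≤_)
open import Data.List using (List; []; _∷_; _++_; replicate; concatMap; map; upTo; length)
open import Data.Product using (∃; ∃-syntax; _×_)
open import Data.Integer using (+_; _-_; ∣_∣)
open import Relation.Binary.PropositionalEquality using (_≡_)
open import Relation.Nullary using (Dec; yes; no)
open import Function using (_∘_)

data Letter : Set where
  L S M : Letter

_≟L_ : (a b : Letter) → Dec (a ≡ b)
L ≟L L = yes _≡_.refl
S ≟L S = yes _≡_.refl
M ≟L M = yes _≡_.refl
L ≟L S = no λ ()
L ≟L M = no λ ()
S ≟L L = no λ ()
S ≟L M = no λ ()
M ≟L L = no λ ()
M ≟L S = no λ ()

φ : ℕ → Letter → List Letter
φ p L = replicate p L ++ (S ∷ [])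
φ p S = M ∷ []
φ p M = replicate (p ∸ 1) L ++ (S ∷ [])

φ* : ℕ → List Letter → List Letter
φ* p = concatMap (φ p)

iter : ℕ → ℕ → List Letter
iter p zero    = L ∷ []
iter p (suc k) = φ* p (iter p k)

nth : List Letter → ℕ → Letter
nth []       _       = L
nth (x ∷ _)  zero    = x
nth (_ ∷ xs) (suc n) = nth xs n

-- The fixed point u^(p) = lim φ_p^n(L), as an infinite word ℕ → Letter:
-- its n-th letter is the n-th letter of φ_p^(n+1)(L) (for p > 1 each φ_p^k(L)
-- is a prefix of φ_p^(k+1)(L) and |φ_p^(n+1)(L)| > n, so this is the limit).
u : ℕ → ℕ → Letter
u p n = nth (iter p (suc n)) n

factorAt : (ℕ → Letter) → ℕ → ℕ → List Letter
factorAt x i n = map (λ k → x (i + k)) (upTo n)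

IsFactor : (ℕ → Letter) → List Letter → Set
IsFactor x v = ∃[ i ] ∃[ n ] (v ≡ factorAt x i n)

occ : Letter → List Letter → ℕ
occ a []       = 0
occ a (x ∷ xs) with x ≟L a
... | yes _ = suc (occ a xs)
... | no  _ = occ a xs

occDiff : Letter → List Letter → List Letter → ℕ
occDiff a v w = ∣ + occ a v - + occ a w ∣

Balanced : ℕ → Letter → (ℕ → Letter) → Set
Balanced c a x = ∀ (v w : List Letter) → IsFactor x v → IsFactor x w →
                 length v ≡ length w → occDiff a v w ≤ c

Attained : ℕ → Letter → (ℕ → Letter) → Set
Attained c a x = ∃[ v ] ∃[ w ] (IsFactor x v × IsFactor x w ×
                 length v ≡ length w × occDiff a v w ≡ c)

{-# OPTIONS --safe #-}
module Submission where

-- Idea.  A prefix of φ_p^k(L) with Parikh vector v that is followed by the letter c gives,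
-- at level k + 1, the prefixes with Parikh vectors A v + j e_L, where A is the incidence
-- matrix of φ_p and L^j d is a prefix of φ_p(c).  Hence the difference (l , s , m) of the
-- Parikh vectors of two factors is the last term of a sequence that starts at 0 and obeys
-- (l , s , m) ↦ (p l + (p-1) m + δ , l + m , s), where δ is a signed sum of the digits of
-- the four endpoints.  If one factor is too long relative to the other, it stays so at all
-- further levels (the difference, less the letters following the endpoints of the shorter
-- side, remains in a cone preserved by A), and then the two lengths differ at every level.
-- As long as this has not happened, |s| ≤ 2 and |m| ≤ 2 when p ≥ 4: otherwise l + m ≥ 3 at
-- some step, and then the digits are too small to prevent an escape into the cone.  For
-- p = 2 and p = 3 the differences that have not escaped form a finite set, which is
-- enumerated.

open import Defs
open import Data.Bool using (Bool; true; false; _∧_; _∨_; not; T; if_then_else_)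
open import Data.Bool.ListAction using (all)
open import Data.Bool.Properties using (T-∧; T-∨)
open import Data.Empty using (⊥; ⊥-elim)
open import Data.List using (List; []; _∷_; _++_; length; map; upTo; cartesianProductWith; deduplicate)
open import Data.List.Properties using (length-map; length-upTo)
open import Data.List.Membership.Propositional using (_∈_)
open import Data.List.Membership.Propositional.Properties using
  (∈-upTo⁺; ∈-map⁺; ∈-++⁺ˡ; ∈-++⁺ʳ; ∈-cartesianProductWith⁺; ∈-deduplicate⁺)
open import Data.List.Relation.Unary.All as All using ()
open import Data.List.Relation.Unary.All.Properties using (all⁺)
open import Data.List.Relation.Unary.Any using (here)
open import Data.Nat as ℕ using (ℕ; zero; suc; z≤n; s≤s; _<_; _<ᵇ_; _≡ᵇ_)
import Data.Nat.Properties as ℕₚ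
open import Data.Product using (_×_; _,_; proj₁; proj₂)
open import Data.Product.Properties using (≡-dec)
open import Data.Sum as Sum using (_⊎_; inj₁; inj₂)
open import Data.Unit using (tt)
open import Function.Bundles using (module Equivalence)
open import Relation.Binary.PropositionalEquality
open import Relation.Nullary using (Dec; yes; no)
open import Relation.Nullary.Decidable using (⌊_⌋; toWitness)

-- Prefixes of the fixed point

module Prefixes where

  open import Data.Nat using (_+_; _*_; _≤_)
  open import Data.Nat.Properties hiding (_≟_)
  open import Data.Nat.Tactic.RingSolver using (solve-∀)
  open import Data.List using (replicate; applyUpTo)
  open import Data.List.Properties using
    (++-assoc; ++-identityʳ; length-++; length-applyUpTo; map-upTo; concatMap-++; ∷-injectiveˡ; ∷-injectiveʳ)
  open import Data.Product using (∃-syntax)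
  open import Function using (_∘_)

  occ-++ : ∀ c xs ys → occ c (xs ++ ys) ≡ occ c xs + occ c ys
  occ-++ c []       ys = refl
  occ-++ c (x ∷ xs) ys with x ≟L c
  ... | yes _ = cong suc (occ-++ c xs ys)
  ... | no _  = occ-++ c xs ys

  length≡occ : ∀ xs → length xs ≡ occ L xs + occ S xs + occ M xs
  length≡occ []       = refl
  length≡occ (L ∷ xs) = cong suc (length≡occ xs)
  length≡occ (S ∷ xs) = trans (cong suc (length≡occ xs)) (cong (_+ occ M xs) (sym (+-suc (occ L xs) _)))
  length≡occ (M ∷ xs) = trans (cong suc (length≡occ xs)) (sym (+-suc (occ L xs + occ S xs) _))

  ++-≡-++ : ∀ {A : Set} us vs xs {a : A} {ys} → us ++ vs ≡ xs ++ a ∷ ys →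
            (∃[ ys′ ] us ≡ xs ++ a ∷ ys′) ⊎ (∃[ zs ] xs ≡ us ++ zs × vs ≡ zs ++ a ∷ ys)
  ++-≡-++ []       vs xs       eq   = inj₂ (xs , refl , eq)
  ++-≡-++ (x ∷ us) vs []       refl = inj₁ (us , refl)
  ++-≡-++ (x ∷ us) vs (y ∷ xs) eq with ∷-injectiveˡ eq | ++-≡-++ us vs xs (∷-injectiveʳ eq)
  ... | refl | inj₁ (ys′ , refl)       = inj₁ (ys′ , refl)
  ... | refl | inj₂ (zs , refl , refl) = inj₂ (zs , refl , refl)

  splitAt-length : ∀ {A : Set} n (ws : List A) → n < length ws →
                   ∃[ xs ] ∃[ a ] ∃[ ys ] ws ≡ xs ++ a ∷ ys × length xs ≡ n
  splitAt-length zero    (w ∷ ws) _       = [] , w , ws , refl , refl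
  splitAt-length (suc n) (w ∷ ws) (s≤s h) with splitAt-length n ws h
  ... | xs , a , ys , refl , refl = w ∷ xs , a , ys , refl , refl

  applyUpTo-++ : ∀ {A : Set} (f : ℕ → A) m n → applyUpTo f (m + n) ≡ applyUpTo f m ++ applyUpTo (f ∘ (m +_)) n
  applyUpTo-++ f zero    n = refl
  applyUpTo-++ f (suc m) n = cong (f 0 ∷_) (applyUpTo-++ (f ∘ suc) m n)

  nth-++ : ∀ xs ys {i} → i < length xs → nth (xs ++ ys) i ≡ nth xs i
  nth-++ (x ∷ xs) ys {zero}  _       = refl
  nth-++ (x ∷ xs) ys {suc i} (s≤s h) = nth-++ xs ys h

  applyUpTo-nth : ∀ f xs → (∀ {i} → i < length xs → nth xs i ≡ f i) → xs ≡ applyUpTo f (length xs)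
  applyUpTo-nth f []       _ = refl
  applyUpTo-nth f (x ∷ xs) h = cong₂ _∷_ (h (s≤s z≤n)) (applyUpTo-nth (f ∘ suc) xs (h ∘ s≤s))

  φ-nonempty : ∀ q c → ∃[ z ] ∃[ zs ] φ (suc q) c ≡ z ∷ zs
  φ-nonempty q       L = L , _ , refl
  φ-nonempty q       S = M , _ , refl
  φ-nonempty zero    M = S , _ , refl
  φ-nonempty (suc q) M = L , _ , refl

  module _ (q : ℕ) where

    -- Writing p as `suc q` lets `p ∸ 1` reduce to `q` in the image of `M`.
    private
      p : ℕ
      p = suc q

    -- No letter has an empty image, so applying `φ*` to the decomposition at one level leaves a
    -- nonempty tail at the next. This is what makes the lengths grow.
    iter-extend : ∀ k → ∃[ z ] ∃[ zs ] iter p (suc k) ≡ iter p k ++ z ∷ zs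
    iter-extend zero    = extend q
      where
        extend : ∀ n → ∃[ z ] ∃[ zs ] (L ∷ replicate n L ++ S ∷ []) ++ [] ≡ L ∷ z ∷ zs
        extend zero    = S , [] , refl
        extend (suc n) = L , _ , refl
    iter-extend (suc k) with iter-extend k
    ... | z , zs , eq with φ-nonempty q z
    ...   | y , ys , eq′ = y , ys ++ φ* p zs ,
      (begin
        φ* p (iter p (suc k))                 ≡⟨ cong (φ* p) eq ⟩
        φ* p (iter p k ++ z ∷ zs)             ≡⟨ concatMap-++ (φ p) (iter p k) (z ∷ zs) ⟩
        iter p (suc k) ++ φ p z ++ φ* p zs    ≡⟨ cong (λ w → iter p (suc k) ++ w ++ φ* p zs) eq′ ⟩
        iter p (suc k) ++ y ∷ ys ++ φ* p zs   ∎)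
      where open ≡-Reasoning

    length-iter : ∀ k → k < length (iter p k)
    length-iter zero    = s≤s z≤n
    length-iter (suc k) with iter-extend k
    ... | z , zs , eq rewrite eq | length-++ (iter p k) {z ∷ zs} | +-suc (length (iter p k)) (length zs)
      = s≤s (≤-trans (length-iter k) (m≤m+n _ _))

    iter-mono : ∀ d k → ∃[ zs ] iter p (d + k) ≡ iter p k ++ zs
    iter-mono zero    k = [] , sym (++-identityʳ _)
    iter-mono (suc d) k with iter-mono d k | iter-extend (d + k)
    ... | zs , eq | y , ys , eq′ = zs ++ y ∷ ys , trans eq′ (trans (cong (_++ y ∷ ys) eq) (++-assoc (iter p k) zs _))

    -- `u p i` is read off the iterate with index `suc i`. Of two iterates one is a prefix of the
    -- other, so they agree wherever both are defined.
    nth-iter : ∀ k {i} → i < length (iter p k) → nth (iter p k) i ≡ u p i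
    nth-iter k {i} i< with ≤-total k (suc i)
    ... | inj₁ k≤ with iter-mono (suc i ℕ.∸ k) k
    ...   | zs , eq rewrite m∸n+n≡m k≤ = sym (trans (cong (λ w → nth w i) eq) (nth-++ (iter p k) zs i<))
    nth-iter k {i} i< | inj₂ ≤k with iter-mono (k ℕ.∸ suc i) (suc i)
    ...   | zs , eq rewrite m∸n+n≡m ≤k =
      trans (cong (λ w → nth w i) eq) (nth-++ (iter p (suc i)) zs (<-trans (n<1+n i) (length-iter (suc i))))

    iter-prefix : ∀ k xs {ys} → iter p k ≡ xs ++ ys → xs ≡ applyUpTo (u p) (length xs)
    iter-prefix k xs {ys} eq = applyUpTo-nth (u p) xs λ {i} i< →
      trans (sym (nth-++ xs ys i<))
        (trans (cong (λ w → nth w i) (sym eq))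
          (nth-iter k (subst (λ w → i < length w) (sym eq)
            (≤-trans i< (subst (length xs ≤_) (sym (length-++ xs)) (m≤m+n _ _))))))

    -- Step c j d: the word φ p c has the prefix L^j, followed by the letter d.
    data Step : Letter → ℕ → Letter → Set where
      L→L : ∀ {j} → j < p → Step L j L
      L→S : Step L p S
      S→M : Step S 0 M
      M→L : ∀ {j} → j < q → Step M j L
      M→S : Step M q S

    -- Prefix k l s m a: the word φ_p^k(L) has a prefix with l, s, m occurrences of
    -- L, S, M that is followed by the letter a.
    data Prefix : ℕ → ℕ → ℕ → ℕ → Letter → Set where
      empty : Prefix 0 0 0 0 L
      _▹_   : ∀ {k l s m a j b} → Prefix k l s m a → Step a j b →
              Prefix (suc k) (p * l + q * m + j) (l + m) s b

    occ-replicate : ∀ n → occ L (replicate n L) ≡ n × occ S (replicate n L) ≡ 0 × occ M (replicate n L) ≡ 0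
    occ-replicate zero    = refl , refl , refl
    occ-replicate (suc n) with occ-replicate n
    ... | l , s , m = cong suc l , s , m

    occ-L^S : ∀ n w → occ L ((replicate n L ++ S ∷ []) ++ w) ≡ n + occ L w ×
                      occ S ((replicate n L ++ S ∷ []) ++ w) ≡ suc (occ S w) ×
                      occ M ((replicate n L ++ S ∷ []) ++ w) ≡ occ M w
    occ-L^S zero    w = refl , refl , refl
    occ-L^S (suc n) w with occ-L^S n w
    ... | l , s , m = cong suc l , s , m

    -- The incidence matrix of φ_p, with columns (p, 1, 0), (0, 0, 1), (q, 1, 0) for `L`, `S`, `M`.
    occ-φ* : ∀ w → occ L (φ* p w) ≡ p * occ L w + q * occ M w ×
                   occ S (φ* p w) ≡ occ L w + occ M w ×
                   occ M (φ* p w) ≡ occ S w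
    occ-φ* []      = sym (trans (cong₂ _+_ (*-zeroʳ p) (*-zeroʳ q)) refl) , refl , refl
    occ-φ* (L ∷ w) with occ-φ* w | occ-L^S p (φ* p w)
    ... | l , s , m | l′ , s′ , m′ =
      trans l′ (trans (cong (p +_) l) (lemma q (occ L w) (occ M w))) , trans s′ (cong suc s) , trans m′ m
      where
        lemma : ∀ q x y → suc q + (suc q * x + q * y) ≡ suc q * suc x + q * y
        lemma = solve-∀
    occ-φ* (S ∷ w) with occ-φ* w
    ... | l , s , m = l , s , cong suc m
    occ-φ* (M ∷ w) with occ-φ* w | occ-L^S q (φ* p w)
    ... | l , s , m | l′ , s′ , m′ =
      trans l′ (trans (cong (q +_) l) (lemma q (occ L w) (occ M w))) ,
      trans s′ (trans (cong suc s) (sym (+-suc (occ L w) _))) , trans m′ m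
      where
        lemma : ∀ q x y → q + (suc q * x + q * y) ≡ suc q * x + q * suc y
        lemma = solve-∀

    -- Desubstitution of a cut: images of letters are stripped off the front until the cut falls
    -- inside one of them.
    φ*-split : ∀ w xs {a ys} → φ* p w ≡ xs ++ a ∷ ys →
      ∃[ w₁ ] ∃[ c ] ∃[ w₂ ] ∃[ zs ] ∃[ ys′ ]
        w ≡ w₁ ++ c ∷ w₂ × xs ≡ φ* p w₁ ++ zs × φ p c ≡ zs ++ a ∷ ys′
    φ*-split []      []      ()
    φ*-split []      (_ ∷ _) ()
    φ*-split (c ∷ w) xs eq with ++-≡-++ (φ p c) (φ* p w) xs eq
    ... | inj₁ (ys′ , eq′) = [] , c , w , xs , ys′ , refl , refl , eq′
    ... | inj₂ (xs′ , refl , eq′) with φ*-split w xs′ eq′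
    ...   | w₁ , d , w₂ , zs , ys′ , refl , refl , eq″ =
      c ∷ w₁ , d , w₂ , zs , ys′ , refl , sym (++-assoc (φ p c) (φ* p w₁) zs) , eq″

    L^S-split : ∀ n zs {a ys} → replicate n L ++ S ∷ [] ≡ zs ++ a ∷ ys →
                ∃[ j ] zs ≡ replicate j L × ((j < n × a ≡ L) ⊎ (j ≡ n × a ≡ S))
    L^S-split zero    []           refl = 0 , refl , inj₂ (refl , refl)
    L^S-split zero    (_ ∷ [])     ()
    L^S-split zero    (_ ∷ _ ∷ _)  ()
    L^S-split (suc n) []           refl = 0 , refl , inj₁ (s≤s z≤n , refl)
    L^S-split (suc n) (z ∷ zs)     eq with ∷-injectiveˡ eq | L^S-split n zs (∷-injectiveʳ eq)
    ... | refl | j , refl , inj₁ (j< , a≡) = suc j , refl , inj₁ (s≤s j< , a≡)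
    ... | refl | j , refl , inj₂ (j≡ , a≡) = suc j , refl , inj₂ (cong suc j≡ , a≡)

    φ-split : ∀ c zs {a ys} → φ p c ≡ zs ++ a ∷ ys → ∃[ j ] zs ≡ replicate j L × Step c j a
    φ-split L zs eq with L^S-split p zs eq
    ... | j , zs≡ , inj₁ (j< , refl)   = j , zs≡ , L→L j<
    ... | j , zs≡ , inj₂ (refl , refl) = j , zs≡ , L→S
    φ-split S []          refl = 0 , refl , S→M
    φ-split S (_ ∷ [])    ()
    φ-split S (_ ∷ _ ∷ _) ()
    φ-split M zs eq with L^S-split q zs eq
    ... | j , zs≡ , inj₁ (j< , refl)   = j , zs≡ , M→L j<
    ... | j , zs≡ , inj₂ (refl , refl) = j , zs≡ , M→S

    L^S-join : ∀ {j n} → j < n → ∃[ ys ] replicate n L ++ S ∷ [] ≡ replicate j L ++ L ∷ ys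
    L^S-join {zero}  (s≤s _) = _ , refl
    L^S-join {suc j} (s≤s h) with L^S-join h
    ... | ys , eq = ys , cong (L ∷_) eq

    φ-join : ∀ {c j a} → Step c j a → ∃[ ys ] φ p c ≡ replicate j L ++ a ∷ ys
    φ-join (L→L j<) = L^S-join j<
    φ-join L→S = [] , refl
    φ-join S→M = [] , refl
    φ-join (M→L j<) = L^S-join j<
    φ-join M→S = [] , refl

    occ-φ*-++ : ∀ w j → occ L (φ* p w ++ replicate j L) ≡ p * occ L w + q * occ M w + j ×
                        occ S (φ* p w ++ replicate j L) ≡ occ L w + occ M w ×
                        occ M (φ* p w ++ replicate j L) ≡ occ S w
    occ-φ*-++ w j with occ-φ* w | occ-replicate j
    ... | l , s , m | l′ , s′ , m′ =
      trans (occ-++ L (φ* p w) _) (cong₂ _+_ l l′) ,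
      trans (occ-++ S (φ* p w) _) (trans (cong₂ _+_ s s′) (+-identityʳ _)) ,
      trans (occ-++ M (φ* p w) _) (trans (cong₂ _+_ m m′) (+-identityʳ _))

    -- Desubstituting a cut level by level, down to the single letter `L`, yields its digits. The
    -- upper bounds rest on this direction, sharpness on `Prefix-sound`.
    Prefix-complete : ∀ k xs {a ys} → iter p k ≡ xs ++ a ∷ ys → Prefix k (occ L xs) (occ S xs) (occ M xs) a
    Prefix-complete zero    []          refl = empty
    Prefix-complete zero    (_ ∷ [])    ()
    Prefix-complete zero    (_ ∷ _ ∷ _) ()
    Prefix-complete (suc k) xs eq with φ*-split (iter p k) xs eq
    ... | w₁ , c , w₂ , zs , ys′ , eq₁ , refl , eq₂ with φ-split c zs eq₂
    ...   | j , refl , st with occ-φ*-++ w₁ j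
    ...     | l , s , m rewrite l | s | m = Prefix-complete k w₁ eq₁ ▹ st

    Prefix-sound : ∀ {k l s m a} → Prefix k l s m a →
      ∃[ xs ] ∃[ ys ] iter p k ≡ xs ++ a ∷ ys × occ L xs ≡ l × occ S xs ≡ s × occ M xs ≡ m
    Prefix-sound empty = [] , [] , refl , refl , refl , refl
    Prefix-sound (_▹_ {k} {a = c} {j = j} {b = b} pre st) with Prefix-sound pre | φ-join st
    ... | xs , ys , eq , refl , refl , refl | zs , eq′ =
      φ* p xs ++ replicate j L , zs ++ φ* p ys , eq″ , occ-φ*-++ xs j
      where
        open ≡-Reasoning
        eq″ : iter p (suc k) ≡ (φ* p xs ++ replicate j L) ++ b ∷ zs ++ φ* p ys
        eq″ = begin
          φ* p (iter p k)                                    ≡⟨ cong (φ* p) eq ⟩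
          φ* p (xs ++ c ∷ ys)                                ≡⟨ concatMap-++ (φ p) xs (c ∷ ys) ⟩
          φ* p xs ++ φ p c ++ φ* p ys                        ≡⟨ cong (λ w → φ* p xs ++ w ++ φ* p ys) eq′ ⟩
          φ* p xs ++ (replicate j L ++ b ∷ zs) ++ φ* p ys    ≡⟨ cong (φ* p xs ++_) (++-assoc (replicate j L) (b ∷ zs) _) ⟩
          φ* p xs ++ replicate j L ++ b ∷ zs ++ φ* p ys      ≡⟨ ++-assoc (φ* p xs) (replicate j L) _ ⟨
          (φ* p xs ++ replicate j L) ++ b ∷ zs ++ φ* p ys    ∎

    count : Letter → ℕ → ℕ
    count c n = occ c (applyUpTo (u p) n)

    -- Since φ_p^K(L) is longer than K, one level serves all positions up to K. Hence the four
    -- endpoints of two factors can be followed together.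
    count-prefix : ∀ K n → n ≤ K → ∃[ a ] Prefix K (count L n) (count S n) (count M n) a
    count-prefix K n n≤K with splitAt-length n (iter p K) (<-≤-trans (s≤s n≤K) (length-iter K))
    ... | xs , a , ys , eq , refl rewrite sym (iter-prefix K xs eq) = a , Prefix-complete K xs eq

    prefix-count : ∀ {k l s m a} → Prefix k l s m a →
      count L (l + s + m) ≡ l × count S (l + s + m) ≡ s × count M (l + s + m) ≡ m
    prefix-count {k} pre with Prefix-sound pre
    ... | xs , ys , eq , refl , refl , refl rewrite sym (length≡occ xs) | sym (iter-prefix k xs eq) = refl , refl , refl

    count-total : ∀ n → count L n + count S n + count M n ≡ n
    count-total n = trans (sym (length≡occ (applyUpTo (u p) n))) (length-applyUpTo (u p) n)

    occ-factorAt : ∀ c i n → count c i + occ c (factorAt (u p) i n) ≡ count c (i + n)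
    occ-factorAt c i n rewrite map-upTo (λ k → u p (i + k)) n =
      trans (sym (occ-++ c (applyUpTo (u p) i) _)) (cong (occ c) (sym (applyUpTo-++ (u p) i n)))

open Prefixes
open import Data.Integer using (ℤ; +_; -[1+_]; 0ℤ; 1ℤ; -1ℤ; _+_; _-_; _*_; -_; ∣_∣; _≤_; +≤+; -≤-; _≤ᵇ_)
open import Data.Integer.Properties using
  ( pos-*; +-injective; +-comm; +-identityʳ; +-mono-≤; i≤j⇒0≤j-i; 0≤i-j⇒j≤i; i-j≡0⇒i≡j
  ; drop‿+≤+; ≤ᵇ⇒≤) renaming (_≟_ to _≟ℤ_)
open import Data.Integer.Tactic.RingSolver using (solve-∀)

-- Differences of Parikh vectors

-- The vector is the sum of the Parikh vectors of two prefixes minus that of two others; `a`, `a′`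
-- follow the first two, `b`, `b′` the last two. For factors of length n at i and j, the positive
-- ends are i + n and j, the negative ones i and j + n.
record State : Set where
  constructor state
  field
    l s m      : ℤ
    a a′ b b′  : Letter

advance : ℕ → State → ℕ → Letter → Letter → ℕ → Letter → Letter → State
advance q (state l s m _ _ _ _) i c c′ j d d′ =
  state (+ suc q * l + + q * m + (+ i - + j)) (l + m) s c c′ d d′

start : State
start = state 0ℤ 0ℤ 0ℤ L L L L

-- The premise expresses that the two factors have equal length.
LetterBounds : State → Set
LetterBounds (state l s m _ _ _ _) = l + s + m ≡ 0ℤ → ∣ l ∣ ℕ.≤ 3 × ∣ s ∣ ℕ.≤ 2 × ∣ m ∣ ℕ.≤ 2

-- The common interface of the two proofs of the upper bounds: the inequalities for p ≥ 4 and the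
-- enumeration for p = 2, 3.
record Invariant (q : ℕ) : Set₁ where
  field
    I     : State → Set
    init  : I start
    step  : ∀ {x i i′ j j′ c c′ d d′} → I x →
            Step q (State.a x) i c → Step q (State.a′ x) i′ c′ →
            Step q (State.b x) j d → Step q (State.b′ x) j′ d′ →
            I (advance q x (i ℕ.+ i′) c c′ (j ℕ.+ j′) d d′)
    final : ∀ {x} → I x → LetterBounds x

diff : ℕ → ℕ → ℕ → ℕ → ℤ
diff x x′ y y′ = + (x ℕ.+ x′) - + (y ℕ.+ y′)

diff-advance : ∀ q l₁ l₂ l₃ l₄ m₁ m₂ m₃ m₄ i₁ i₂ i₃ i₄ →
  let f = λ l m i → suc q ℕ.* l ℕ.+ q ℕ.* m ℕ.+ i in
  + suc q * diff l₁ l₂ l₃ l₄ + + q * diff m₁ m₂ m₃ m₄ + (+ (i₁ ℕ.+ i₂) - + (i₃ ℕ.+ i₄)) ≡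
  diff (f l₁ m₁ i₁) (f l₂ m₂ i₂) (f l₃ m₃ i₃) (f l₄ m₄ i₄)
diff-advance q l₁ l₂ l₃ l₄ m₁ m₂ m₃ m₄ i₁ i₂ i₃ i₄
  = trans (lemma (+ suc q) (+ q) (+ l₁) (+ l₂) (+ l₃) (+ l₄) (+ m₁) (+ m₂) (+ m₃) (+ m₄) (+ i₁) (+ i₂) (+ i₃) (+ i₄))
      (cong₂ _-_ (cong₂ _+_ (cast l₁ m₁ i₁) (cast l₂ m₂ i₂)) (cong₂ _+_ (cast l₃ m₃ i₃) (cast l₄ m₄ i₄)))
  where
    cast : ∀ l m i → + suc q * + l + + q * + m + + i ≡ + (suc q ℕ.* l ℕ.+ q ℕ.* m ℕ.+ i)
    cast l m i = cong (_+ + i) (cong₂ _+_ (sym (pos-* (suc q) l)) (sym (pos-* q m)))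
    lemma : ∀ p q l₁ l₂ l₃ l₄ m₁ m₂ m₃ m₄ i₁ i₂ i₃ i₄ →
      p * (l₁ + l₂ - (l₃ + l₄)) + q * (m₁ + m₂ - (m₃ + m₄)) + (i₁ + i₂ - (i₃ + i₄)) ≡
      p * l₁ + q * m₁ + i₁ + (p * l₂ + q * m₂ + i₂) - (p * l₃ + q * m₃ + i₃ + (p * l₄ + q * m₄ + i₄))
    lemma = solve-∀

diff-+ : ∀ l₁ l₂ l₃ l₄ m₁ m₂ m₃ m₄ →
  diff l₁ l₂ l₃ l₄ + diff m₁ m₂ m₃ m₄ ≡ diff (l₁ ℕ.+ m₁) (l₂ ℕ.+ m₂) (l₃ ℕ.+ m₃) (l₄ ℕ.+ m₄)
diff-+ l₁ l₂ l₃ l₄ m₁ m₂ m₃ m₄ = lemma (+ l₁) (+ l₂) (+ l₃) (+ l₄) (+ m₁) (+ m₂) (+ m₃) (+ m₄)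
  where
    lemma : ∀ l₁ l₂ l₃ l₄ m₁ m₂ m₃ m₄ →
      l₁ + l₂ - (l₃ + l₄) + (m₁ + m₂ - (m₃ + m₄)) ≡ l₁ + m₁ + (l₂ + m₂) - (l₃ + m₃ + (l₄ + m₄))
    lemma = solve-∀

occDiff-diff : ∀ q c i j n → occDiff c (factorAt (u (suc q)) i n) (factorAt (u (suc q)) j n) ≡
  ∣ diff (count q c (i ℕ.+ n)) (count q c j) (count q c i) (count q c (j ℕ.+ n)) ∣
occDiff-diff q c i j n = cong ∣_∣ (begin
  + occ c v - + occ c w
    ≡⟨ lemma (+ occ c v) (+ occ c w) (+ count q c i) (+ count q c j) ⟩
  -- Adding the counts up to i and j to both sides turns each occurrence number into a count up to
  -- the end of its factor.
  + (count q c i ℕ.+ occ c v ℕ.+ count q c j) - + (count q c i ℕ.+ (count q c j ℕ.+ occ c w))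
    ≡⟨ cong₂ (λ x y → diff x (count q c j) (count q c i) y) (occ-factorAt q c i n) (occ-factorAt q c j n) ⟩
  diff (count q c (i ℕ.+ n)) (count q c j) (count q c i) (count q c (j ℕ.+ n)) ∎)
  where
    open ≡-Reasoning
    v = factorAt (u (suc q)) i n
    w = factorAt (u (suc q)) j n
    lemma : ∀ v w x y → v - w ≡ x + v + y - (x + (y + w))
    lemma = solve-∀

length-factorAt : ∀ x i n → length (factorAt x i n) ≡ n
length-factorAt x i n = trans (length-map (λ k → x (i ℕ.+ k)) (upTo n)) (length-upTo n)

module _ {q : ℕ} (inv : Invariant q) where
  open Invariant inv

  reach : ∀ {k l₁ s₁ m₁ a₁ l₂ s₂ m₂ a₂ l₃ s₃ m₃ a₃ l₄ s₄ m₄ a₄} →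
    Prefix q k l₁ s₁ m₁ a₁ → Prefix q k l₂ s₂ m₂ a₂ → Prefix q k l₃ s₃ m₃ a₃ → Prefix q k l₄ s₄ m₄ a₄ →
    I (state (diff l₁ l₂ l₃ l₄) (diff s₁ s₂ s₃ s₄) (diff m₁ m₂ m₃ m₄) a₁ a₂ a₃ a₄)
  reach empty empty empty empty = init
  reach (_▹_ {l = l₁} {s₁} {m₁} {j = j₁} P₁ t₁) (_▹_ {l = l₂} {s₂} {m₂} {j = j₂} P₂ t₂)
        (_▹_ {l = l₃} {s₃} {m₃} {j = j₃} P₃ t₃) (_▹_ {l = l₄} {s₄} {m₄} {j = j₄} P₄ t₄) =
    subst₂ (λ l s → I (state l s (diff s₁ s₂ s₃ s₄) _ _ _ _))
      (diff-advance q l₁ l₂ l₃ l₄ m₁ m₂ m₃ m₄ j₁ j₂ j₃ j₄)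
      (diff-+ l₁ l₂ l₃ l₄ m₁ m₂ m₃ m₄)
      (step (reach P₁ P₂ P₃ P₄) t₁ t₂ t₃ t₄)

  counts-bounded : ∀ i j n →
    let D = λ c → diff (count q c (i ℕ.+ n)) (count q c j) (count q c i) (count q c (j ℕ.+ n)) in
    ∣ D L ∣ ℕ.≤ 3 × ∣ D S ∣ ℕ.≤ 2 × ∣ D M ∣ ℕ.≤ 2
  counts-bounded i j n = final (reach (at (i ℕ.+ n) (ℕₚ.m≤m+n _ _)) (at j (ℕₚ.≤-trans (ℕₚ.m≤m+n j n) (ℕₚ.m≤n+m _ (i ℕ.+ n))))
      (at i (ℕₚ.≤-trans (ℕₚ.m≤m+n i n) (ℕₚ.m≤m+n _ _))) (at (j ℕ.+ n) (ℕₚ.m≤n+m _ (i ℕ.+ n)))) total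
    where
      open ≡-Reasoning
      -- A common bound for the four endpoints, so that all four are prefixes at the same level.
      K = i ℕ.+ n ℕ.+ (j ℕ.+ n)
      at : ∀ x (x≤K : x ℕ.≤ K) →
           Prefix q K (count q L x) (count q S x) (count q M x) (proj₁ (count-prefix q K x x≤K))
      at x x≤K = proj₂ (count-prefix q K x x≤K)
      D : Letter → ℤ
      D c = diff (count q c (i ℕ.+ n)) (count q c j) (count q c i) (count q c (j ℕ.+ n))
      total : D L + D S + D M ≡ 0ℤ
      total = begin
        D L + D S + D M
          ≡⟨ cong (_+ D M) (diff-+ (count q L (i ℕ.+ n)) (count q L j) (count q L i) (count q L (j ℕ.+ n)) _ _ _ _) ⟩
        diff (N′ (i ℕ.+ n)) (N′ j) (N′ i) (N′ (j ℕ.+ n)) + D M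
          ≡⟨ diff-+ (N′ (i ℕ.+ n)) (N′ j) (N′ i) (N′ (j ℕ.+ n)) _ _ _ _ ⟩
        diff (N (i ℕ.+ n)) (N j) (N i) (N (j ℕ.+ n))
          ≡⟨ cong₂ _-_ (cong +_ (cong₂ ℕ._+_ (count-total q (i ℕ.+ n)) (count-total q j)))
                       (cong +_ (cong₂ ℕ._+_ (count-total q i) (count-total q (j ℕ.+ n)))) ⟩
        diff (i ℕ.+ n) j i (j ℕ.+ n)
          ≡⟨ lemma (+ i) (+ j) (+ n) ⟩
        0ℤ ∎
        where
          N′ N : ℕ → ℕ
          N′ x = count q L x ℕ.+ count q S x
          N x = N′ x ℕ.+ count q M x
          lemma : ∀ i j n → i + n + j - (i + (j + n)) ≡ 0ℤ
          lemma = solve-∀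

  balanced : Balanced 3 L (u (suc q)) × Balanced 2 S (u (suc q)) × Balanced 2 M (u (suc q))
  balanced = from L (λ i j n → proj₁ (counts-bounded i j n)) ,
             from S (λ i j n → proj₁ (proj₂ (counts-bounded i j n))) ,
             from M (λ i j n → proj₂ (proj₂ (counts-bounded i j n)))
    where
      from : ∀ {b} c →
        (∀ i j n → ∣ diff (count q c (i ℕ.+ n)) (count q c j) (count q c i) (count q c (j ℕ.+ n)) ∣ ℕ.≤ b) →
        Balanced b c (u (suc q))
      from c h _ _ (i , n , refl) (j , n′ , refl) eq
        with trans (sym (length-factorAt (u (suc q)) i n)) (trans eq (length-factorAt (u (suc q)) j n′))
      ... | refl = subst (ℕ._≤ _) (sym (occDiff-diff q c i j n)) (h i j n)

-- Sharpness

-- Three prefixes of the same φ_p^k(L); l, s, m is the Parikh vector of the first two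
-- together minus that of the third.
record Triple (q : ℕ) (l s m : ℤ) (a₁ a₂ a₃ : Letter) : Set where
  constructor triple
  field
    {k l₁ s₁ m₁ l₂ s₂ m₂ l₃ s₃ m₃} : ℕ
    P₁ : Prefix q k l₁ s₁ m₁ a₁
    P₂ : Prefix q k l₂ s₂ m₂ a₂
    P₃ : Prefix q k l₃ s₃ m₃ a₃
    l≡ : diff l₁ l₂ 0 l₃ ≡ l
    s≡ : diff s₁ s₂ 0 s₃ ≡ s
    m≡ : diff m₁ m₂ 0 m₃ ≡ m

empties : ∀ {q} → Triple q 0ℤ 0ℤ 0ℤ L L L
empties = triple empty empty empty refl refl refl

extend : ∀ {q l s m a₁ a₂ a₃ j₁ j₂ j₃ b₁ b₂ b₃ l′ s′} → Triple q l s m a₁ a₂ a₃ →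
         Step q a₁ j₁ b₁ → Step q a₂ j₂ b₂ → Step q a₃ j₃ b₃ →
         + suc q * l + + q * m + (+ (j₁ ℕ.+ j₂) - + j₃) ≡ l′ → l + m ≡ s′ →
         Triple q l′ s′ s b₁ b₂ b₃
extend {q} {j₁ = j₁} {j₂} {j₃} (triple {l₁ = l₁} {_} {m₁} {l₂} {_} {m₂} {l₃} {_} {m₃} P₁ P₂ P₃ refl refl refl) t₁ t₂ t₃ refl refl =
  triple (P₁ ▹ t₁) (P₂ ▹ t₂) (P₃ ▹ t₃)
    (trans (cong (λ z → + (f l₁ m₁ j₁ ℕ.+ f l₂ m₂ j₂) - + (z ℕ.+ f l₃ m₃ j₃)) (sym zero′))
      (sym (diff-advance q l₁ l₂ 0 l₃ m₁ m₂ 0 m₃ j₁ j₂ 0 j₃)))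
    (sym (diff-+ l₁ l₂ 0 l₃ m₁ m₂ 0 m₃)) refl
  where
    f : ℕ → ℕ → ℕ → ℕ
    f l m j = suc q ℕ.* l ℕ.+ q ℕ.* m ℕ.+ j
    -- The fourth endpoint is position 0: its Parikh vector stays 0 under steps with digit 0.
    zero′ : f 0 0 0 ≡ 0
    zero′ = trans (ℕₚ.+-identityʳ _) (cong₂ ℕ._+_ (ℕₚ.*-zeroʳ q) (ℕₚ.*-zeroʳ q))

letterCount : Letter → ℤ → ℤ → ℤ → ℤ
letterCount L l s m = l
letterCount S l s m = s
letterCount M l s m = m

-- The first prefix is itself one factor; the other runs from the end of the second prefix to the
-- end of the third. The vanishing sum makes their lengths equal.
attained : ∀ {q l s m a₁ a₂ a₃} c → Triple q l s m a₁ a₂ a₃ → l + s + m ≡ 0ℤ →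
           Attained ∣ letterCount c l s m ∣ c (u (suc q))
attained {q} c (triple {l₁ = l₁} {s₁} {m₁} {l₂} {s₂} {m₂} {l₃} {s₃} {m₃} P₁ P₂ P₃ refl refl refl) total =
  factorAt x 0 N₁ , factorAt x N₂ N₁ , (0 , N₁ , refl) , (N₂ , N₁ , refl) ,
  trans (length-factorAt x 0 N₁) (sym (length-factorAt x N₂ N₁)) ,
  trans (occDiff-diff q c 0 N₂ N₁) (cong ∣_∣ (value c))
  where
    x = u (suc q)
    N₁ = l₁ ℕ.+ s₁ ℕ.+ m₁
    N₂ = l₂ ℕ.+ s₂ ℕ.+ m₂
    N₃ = l₃ ℕ.+ s₃ ℕ.+ m₃
    N≡ : N₂ ℕ.+ N₁ ≡ N₃
    N≡ = trans (ℕₚ.+-comm N₂ N₁) (+-injective (i-j≡0⇒i≡j (+ (N₁ ℕ.+ N₂)) (+ N₃) (trans (sym sum) total)))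
      where
        sum : diff l₁ l₂ 0 l₃ + diff s₁ s₂ 0 s₃ + diff m₁ m₂ 0 m₃ ≡ diff N₁ N₂ 0 N₃
        sum = trans (cong (_+ diff m₁ m₂ 0 m₃) (diff-+ l₁ l₂ 0 l₃ s₁ s₂ 0 s₃)) (diff-+ (l₁ ℕ.+ s₁) (l₂ ℕ.+ s₂) 0 (l₃ ℕ.+ s₃) m₁ m₂ 0 m₃)
    combine : ∀ {c y₁ y₂ y₃} → count q c N₁ ≡ y₁ → count q c N₂ ≡ y₂ → count q c N₃ ≡ y₃ →
              diff (count q c N₁) (count q c N₂) 0 (count q c (N₂ ℕ.+ N₁)) ≡ diff y₁ y₂ 0 y₃
    combine {c} refl refl refl = cong (λ n → diff (count q c N₁) (count q c N₂) 0 (count q c n)) N≡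
    value : ∀ c → diff (count q c N₁) (count q c N₂) (count q c 0) (count q c (N₂ ℕ.+ N₁)) ≡
                  letterCount c (diff l₁ l₂ 0 l₃) (diff s₁ s₂ 0 s₃) (diff m₁ m₂ 0 m₃)
    value L = combine {L} (proj₁ (prefix-count q P₁)) (proj₁ (prefix-count q P₂)) (proj₁ (prefix-count q P₃))
    value S = combine {S} (proj₁ (proj₂ (prefix-count q P₁))) (proj₁ (proj₂ (prefix-count q P₂))) (proj₁ (proj₂ (prefix-count q P₃)))
    value M = combine {M} (proj₂ (proj₂ (prefix-count q P₁))) (proj₂ (proj₂ (prefix-count q P₂))) (proj₂ (proj₂ (prefix-count q P₃)))

module _ (r : ℕ) where
  -- Here p = r + 2, so `R` is p - 2; the vectors reached below do not depend on it.
  private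
    q : ℕ
    q = suc r

    R : ℤ
    R = + r

    -- The digit sequences were found by a search for ones that work for all p ≥ 2.
    common : Triple q -1ℤ 0ℤ -1ℤ L L L
    common = extend (extend (extend empties
      (L→L (s≤s z≤n)) (L→L (s≤s z≤n)) (L→L (s≤s (s≤s z≤n))) (e₁ R) refl)
      (L→L (s≤s (s≤s z≤n))) (L→L ℕₚ.≤-refl) (L→L (s≤s z≤n)) (e₂ R) refl)
      (L→L (s≤s z≤n)) (L→L (s≤s z≤n)) (L→L (s≤s (s≤s z≤n))) (e₁ R) refl
      where
        e₁ : ∀ R → (+ 2 + R) * 0ℤ + (1ℤ + R) * 0ℤ + (0ℤ - 1ℤ) ≡ -1ℤ
        e₁ = solve-∀
        e₂ : ∀ R → (+ 2 + R) * -1ℤ + (1ℤ + R) * 0ℤ + (+ 2 + R - 0ℤ) ≡ 0ℤ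
        e₂ = solve-∀

    triple-L : Triple q (+ 3) -1ℤ -[1+ 1 ] S S L
    triple-L = extend (extend (extend (extend common
      (L→L ℕₚ.≤-refl) (L→L ℕₚ.≤-refl) (L→L (s≤s z≤n)) (e₄ R) refl)
      (L→L (s≤s (s≤s z≤n))) (L→L ℕₚ.≤-refl) (L→L (s≤s z≤n)) (e₅ R) refl)
      (L→L ℕₚ.≤-refl) (L→L ℕₚ.≤-refl) (L→L (s≤s z≤n)) (e₆ R) refl)
      -- The digits p, p against p - 2 give -(p - 1) + 2p - (p - 2) = 3, which offsets the new s =
      -- -1 and m = -2.
      L→S L→S (L→L {j = r} (ℕₚ.m≤n+m _ 1)) (e₇ R) refl
      where
        e₄ : ∀ R → (+ 2 + R) * -1ℤ + (1ℤ + R) * -1ℤ + ((1ℤ + R) + (1ℤ + R) - 0ℤ) ≡ -1ℤ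
        e₄ = solve-∀
        e₅ : ∀ R → (+ 2 + R) * -1ℤ + (1ℤ + R) * 0ℤ + (+ 2 + R - 0ℤ) ≡ 0ℤ
        e₅ = solve-∀
        e₆ : ∀ R → (+ 2 + R) * 0ℤ + (1ℤ + R) * -[1+ 1 ] + ((1ℤ + R) + (1ℤ + R) - 0ℤ) ≡ 0ℤ
        e₆ = solve-∀
        e₇ : ∀ R → (+ 2 + R) * 0ℤ + (1ℤ + R) * -1ℤ + ((+ 2 + R) + (+ 2 + R) - R) ≡ + 3
        e₇ = solve-∀

    triple-M : Triple q 1ℤ 1ℤ -[1+ 1 ] M M L
    triple-M = extend (extend common
      L→S L→S (L→L (s≤s z≤n)) (e₄ R) refl)
      -- The new m is the previous s = -2; the third digit p - 1 brings l down from p to 1.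
      S→M S→M (L→L ℕₚ.≤-refl) (e₅ R) refl
      where
        e₄ : ∀ R → (+ 2 + R) * -1ℤ + (1ℤ + R) * -1ℤ + ((+ 2 + R) + (+ 2 + R) - 0ℤ) ≡ 1ℤ
        e₄ = solve-∀
        e₅ : ∀ R → (+ 2 + R) * 1ℤ + (1ℤ + R) * 0ℤ + (0ℤ - (1ℤ + R)) ≡ 1ℤ
        e₅ = solve-∀

    triple-S : Triple q 1ℤ -[1+ 1 ] 1ℤ S S M
    triple-S = extend (extend (extend triple-M
      (M→L (s≤s z≤n)) (M→L {j = r} ℕₚ.≤-refl) (L→L (s≤s z≤n)) (e₆ R) refl)
      (L→L (s≤s z≤n)) (L→L (s≤s z≤n)) L→S (e₇ R) refl)
      -- Before this step l = m = -1, hence the new s is -2.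
      L→S L→S S→M (e₈ R) refl
      where
        e₆ : ∀ R → (+ 2 + R) * 1ℤ + (1ℤ + R) * -[1+ 1 ] + (R - 0ℤ) ≡ 0ℤ
        e₆ = solve-∀
        e₇ : ∀ R → (+ 2 + R) * 0ℤ + (1ℤ + R) * 1ℤ + (0ℤ - (+ 2 + R)) ≡ -1ℤ
        e₇ = solve-∀
        e₈ : ∀ R → (+ 2 + R) * -1ℤ + (1ℤ + R) * -1ℤ + ((+ 2 + R) + (+ 2 + R) - 0ℤ) ≡ 1ℤ
        e₈ = solve-∀

  attained-all : Attained 3 L (u (suc q)) × Attained 2 S (u (suc q)) × Attained 2 M (u (suc q))
  attained-all = attained L triple-L refl , attained S triple-S refl , attained M triple-M refl

-- Escape, and the case p ≥ 4

infixl 6 _⊕_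
infixl 7 _⊗_

_⊕_ : ∀ {x y} → 0ℤ ≤ x → 0ℤ ≤ y → 0ℤ ≤ x + y
_⊕_ = +-mono-≤

_⊗_ : ∀ {x y} → 0ℤ ≤ x → 0ℤ ≤ y → 0ℤ ≤ x * y
_⊗_ {+ m} {+ n} _ _ = subst (0ℤ ≤_) (pos-* m n) (+≤+ z≤n)

0≤+ : ∀ {n} → 0ℤ ≤ + n
0≤+ = +≤+ z≤n

-- Inequalities are proved by certificates: known nonnegative terms are combined with `⊕` and `⊗`,
-- and a ring identity turns the combination into the goal.
by : ∀ {x y} → x ≡ y → 0ℤ ≤ x → 0ℤ ≤ y
by refl h = h

0≤x⊎x<0 : ∀ x → 0ℤ ≤ x ⊎ 0ℤ ≤ -1ℤ - x
0≤x⊎x<0 (+ n)    = inj₁ 0≤+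
0≤x⊎x<0 -[1+ n ] = inj₂ (i≤j⇒0≤j-i (-≤- z≤n))

∣∣≤ : ∀ n x → 0ℤ ≤ + n - x → 0ℤ ≤ + n + x → ∣ x ∣ ℕ.≤ n
∣∣≤ n (+ x)    h _ = drop‿+≤+ (0≤i-j⇒j≤i h)
∣∣≤ n -[1+ x ] _ h = drop‿+≤+ (0≤i-j⇒j≤i h)

isL isS isM : Letter → ℤ
isL L = 1ℤ
isL S = 0ℤ
isL M = 0ℤ
isS L = 0ℤ
isS S = 1ℤ
isS M = 0ℤ
isM L = 0ℤ
isM S = 0ℤ
isM M = 1ℤ

0≤isL : ∀ a → 0ℤ ≤ isL a
0≤isL L = 0≤+
0≤isL S = 0≤+
0≤isL M = 0≤+

0≤isM : ∀ a → 0ℤ ≤ isM a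
0≤isM L = 0≤+
0≤isM S = 0≤+
0≤isM M = 0≤+

isS≤1 : ∀ a → 0ℤ ≤ 1ℤ - isS a
isS≤1 L = 0≤+
isS≤1 S = 0≤+
isS≤1 M = 0≤+

isL+isS+isM : ∀ a → isL a + isS a + isM a ≡ 1ℤ
isL+isS+isM L = refl
isL+isS+isM S = refl
isL+isS+isM M = refl

-- The vectors (l , s , m) with nonnegative image under the incidence matrix of φ_p.
record Cone (q : ℕ) (l s m : ℤ) : Set where
  constructor cone
  field
    0≤s   : 0ℤ ≤ s
    0≤l+m : 0ℤ ≤ l + m
    0≤φL  : 0ℤ ≤ + suc q * l + + q * m

-- The letters following the negative endpoints are credited to the shorter side in advance, since
-- their images bound what that side can still gain from its digits.
Ahead : ℕ → (l s m : ℤ) (b b′ : Letter) → Set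
Ahead q l s m b b′ = Cone q (l - (isL b + isL b′)) (s - (isS b + isS b′)) (m - (isM b + isM b′))

-- If the sum were 0, taking away two letters would leave -2, while the cone conditions on s and l +
-- m make the reduced sum nonnegative.
Ahead⇒sum≢0 : ∀ {q} l s m b b′ → Ahead q l s m b b′ → l + s + m ≡ 0ℤ → ⊥
Ahead⇒sum≢0 l s m b b′ (cone h₁ h₂ _) sum≡0 with by (trans (lemma l s m (isL b) (isS b) (isM b) (isL b′) (isS b′) (isM b′)) eq) (h₁ ⊕ h₂)
  where
    lemma : ∀ l s m x y z x′ y′ z′ → s - (y + y′) + (l - (x + x′) + (m - (z + z′))) ≡ l + s + m - (x + y + z + (x′ + y′ + z′))
    lemma = solve-∀
    eq : l + s + m - (isL b + isS b + isM b + (isL b′ + isS b′ + isM b′)) ≡ -[1+ 1 ]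
    eq = cong₂ _-_ sum≡0 (cong₂ _+_ (isL+isS+isM b) (isL+isS+isM b′))
... | ()

module _ (q : ℕ) where
  private
    P Q : ℤ
    P = + suc q
    Q = + q

  -- φ p c is L^j followed by d and a remainder; these are the components of the remainder.
  remainder-L : ∀ {c j d} → Step q c j d → 0ℤ ≤ P * isL c + Q * isM c - + j - isL d
  remainder-L (L→L {j} (s≤s j≤q)) = by (lemma Q (+ j)) (i≤j⇒0≤j-i (+≤+ j≤q))
    where
      lemma : ∀ q j → q - j ≡ (1ℤ + q) * 1ℤ + q * 0ℤ - j - 1ℤ
      lemma = solve-∀
  remainder-L L→S = by (lemma Q) (0≤+ {0})
    where
      lemma : ∀ q → 0ℤ ≡ (1ℤ + q) * 1ℤ + q * 0ℤ - (1ℤ + q) - 0ℤ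
      lemma = solve-∀
  remainder-L S→M = by (lemma Q) (0≤+ {0})
    where
      lemma : ∀ q → 0ℤ ≡ (1ℤ + q) * 0ℤ + q * 0ℤ - 0ℤ - 0ℤ
      lemma = solve-∀
  remainder-L (M→L {j} j<q) = by (lemma Q (+ j)) (i≤j⇒0≤j-i (+≤+ j<q))
    where
      lemma : ∀ q j → q - (1ℤ + j) ≡ (1ℤ + q) * 0ℤ + q * 1ℤ - j - 1ℤ
      lemma = solve-∀
  remainder-L M→S = by (lemma Q) (0≤+ {0})
    where
      lemma : ∀ q → 0ℤ ≡ (1ℤ + q) * 0ℤ + q * 1ℤ - q - 0ℤ
      lemma = solve-∀

  remainder-S : ∀ {c j d} → Step q c j d → 0ℤ ≤ isL c + isM c - isS d
  remainder-S (L→L _) = 0≤+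
  remainder-S L→S     = 0≤+
  remainder-S S→M     = 0≤+
  remainder-S (M→L _) = 0≤+
  remainder-S M→S     = 0≤+

  remainder-M : ∀ {c j d} → Step q c j d → 0ℤ ≤ isS c - isM d
  remainder-M (L→L _) = 0≤+
  remainder-M L→S     = 0≤+
  remainder-M S→M     = 0≤+
  remainder-M (M→L _) = 0≤+
  remainder-M M→S     = 0≤+

  -- A digit equals p only when the next letter is `S`. In `Small-step` this bounds a digit and the
  -- letter subtracted by `Ahead` together, by p.
  j+isL+isM≤p : ∀ {c j d} → Step q c j d → 0ℤ ≤ P - (+ j + isL d + isM d)
  j+isL+isM≤p (L→L {j} (s≤s j≤q)) = by (lemma Q (+ j)) (i≤j⇒0≤j-i (+≤+ j≤q))
    where
      lemma : ∀ q j → q - j ≡ 1ℤ + q - (j + 1ℤ + 0ℤ)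
      lemma = solve-∀
  j+isL+isM≤p L→S = by (lemma Q) (0≤+ {0})
    where
      lemma : ∀ q → 0ℤ ≡ 1ℤ + q - (1ℤ + q + 0ℤ + 0ℤ)
      lemma = solve-∀
  j+isL+isM≤p S→M = 0≤+
  j+isL+isM≤p (M→L {j} j<q) = by (lemma Q (+ j)) (i≤j⇒0≤j-i (+≤+ j<q) ⊕ 0≤+ {1})
    where
      lemma : ∀ q j → q - (1ℤ + j) + 1ℤ ≡ 1ℤ + q - (j + 1ℤ + 0ℤ)
      lemma = solve-∀
  j+isL+isM≤p M→S = by (lemma Q) (0≤+ {1})
    where
      lemma : ∀ q → 1ℤ ≡ 1ℤ + q - (q + 0ℤ + 0ℤ)
      lemma = solve-∀

  -- The leading pair stays ahead: the new difference is the image of the old excess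
  -- plus two remainders and i letters L.
  Ahead-step : ∀ l s m {b b′ j j′ d d′} i {l′ s′ m′} → Ahead q l s m b b′ →
    Step q b j d → Step q b′ j′ d′ →
    P * l + Q * m + (+ i - + (j ℕ.+ j′)) ≡ l′ → l + m ≡ s′ → s ≡ m′ → Ahead q l′ s′ m′ d d′
  Ahead-step l s m {b} {b′} {j} {j′} {d} {d′} i (cone h₁ h₂ h₃) t t′ refl refl refl =
    -- The new reduced vector has nonnegative components, not merely a nonnegative image.
    cone y (x ⊕ z) (0≤+ {suc q} ⊗ x ⊕ 0≤+ {q} ⊗ z)
    where
      x : 0ℤ ≤ P * l + Q * m + (+ i - + (j ℕ.+ j′)) - (isL d + isL d′)
      x = by (lemma P Q l m (isL b) (isL b′) (isM b) (isM b′) (+ i) (+ j) (+ j′) (isL d) (isL d′))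
             (h₃ ⊕ 0≤+ {i} ⊕ remainder-L t ⊕ remainder-L t′)
        where
          lemma : ∀ p q l m b₁ b₁′ b₃ b₃′ i j j′ d d′ →
            p * (l - (b₁ + b₁′)) + q * (m - (b₃ + b₃′)) + i + (p * b₁ + q * b₃ - j - d) + (p * b₁′ + q * b₃′ - j′ - d′) ≡
            p * l + q * m + (i - (j + j′)) - (d + d′)
          lemma = solve-∀
      y : 0ℤ ≤ l + m - (isS d + isS d′)
      y = by (lemma l m (isL b) (isL b′) (isM b) (isM b′) (isS d) (isS d′)) (h₂ ⊕ remainder-S t ⊕ remainder-S t′)
        where
          lemma : ∀ l m b₁ b₁′ b₃ b₃′ d d′ →
            l - (b₁ + b₁′) + (m - (b₃ + b₃′)) + (b₁ + b₃ - d) + (b₁′ + b₃′ - d′) ≡ l + m - (d + d′)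
          lemma = solve-∀
      z : 0ℤ ≤ s - (isM d + isM d′)
      z = by (lemma s (isS b) (isS b′) (isM d) (isM d′)) (h₁ ⊕ remainder-M t ⊕ remainder-M t′)
        where
          lemma : ∀ s b b′ d d′ → s - (b + b′) + (b - d) + (b′ - d′) ≡ s - (d + d′)
          lemma = solve-∀

  -- Negating the vector interchanges the roles of the endpoint pairs, so the second alternative
  -- says that the other side is ahead.
  Escaped : State → Set
  Escaped (state l s m a a′ b b′) = Ahead q l s m b b′ ⊎ Ahead q (- l) (- s) (- m) a a′

  neg-l : ∀ l m i j → P * - l + Q * - m + (j - i) ≡ - (P * l + Q * m + (i - j))
  neg-l = lemma P Q
    where
      lemma : ∀ p q l m i j → p * - l + q * - m + (j - i) ≡ - (p * l + q * m + (i - j))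
      lemma = solve-∀

  neg-s : ∀ l m → - l + - m ≡ - (l + m)
  neg-s = solve-∀

  Escaped-step : ∀ x {i i′ j j′ c c′ d d′} → Escaped x →
    Step q (State.a x) i c → Step q (State.a′ x) i′ c′ →
    Step q (State.b x) j d → Step q (State.b′ x) j′ d′ →
    Escaped (advance q x (i ℕ.+ i′) c c′ (j ℕ.+ j′) d d′)
  Escaped-step (state l s m a a′ b b′) {i} {i′} (inj₁ h) _ _ t t′ =
    inj₁ (Ahead-step l s m (i ℕ.+ i′) h t t′ refl refl refl)
  Escaped-step (state l s m a a′ b b′) {i} {i′} {j} {j′} (inj₂ h) t t′ _ _ =
    inj₂ (Ahead-step (- l) (- s) (- m) (j ℕ.+ j′) h t t′ (neg-l l m (+ (i ℕ.+ i′)) (+ (j ℕ.+ j′))) (neg-s l m) refl)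

  Escaped⇒sum≢0 : ∀ x → Escaped x → State.l x + State.s x + State.m x ≡ 0ℤ → ⊥
  Escaped⇒sum≢0 (state l s m a a′ b b′) (inj₁ h) eq = Ahead⇒sum≢0 l s m b b′ h eq
  Escaped⇒sum≢0 (state l s m a a′ b b′) (inj₂ h) eq =
    Ahead⇒sum≢0 (- l) (- s) (- m) a a′ h (trans (lemma l s m) (cong -_ eq))
    where
      lemma : ∀ l s m → - l + - s + - m ≡ - (l + s + m)
      lemma = solve-∀

module _ (r : ℕ) where
  private
    q : ℕ
    q = 3 ℕ.+ r
    P Q R : ℤ
    P = + suc q
    Q = + q
    R = + r

  -- ps≤ holds after every step, because δ ≥ -2p and the previous m is at most 2;
  -- it excludes (-4 , 2 , 2), which the bounds on s and m do not.
  record Small (l s m : ℤ) : Set where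
    constructor small
    field
      s≤2 : 0ℤ ≤ + 2 - s
      m≤2 : 0ℤ ≤ + 2 - m
      ps≤ : 0ℤ ≤ l - P * s + + 2 * P + + 2

  -- One-sided, to be applied to the vector and to its negation; the bound s ≥ -2 comes from `Small`
  -- for the opposite sign.
  Small-step : ∀ l s m {b b′ j j′ d d′} i {l′ s′ m′} → Small l s m → 0ℤ ≤ + 2 - - s →
    Step q b j d → Step q b′ j′ d′ →
    P * l + Q * m + (+ i - + (j ℕ.+ j′)) ≡ l′ → l + m ≡ s′ → s ≡ m′ →
    Ahead q l′ s′ m′ d d′ ⊎ Small l′ s′ m′
  Small-step l s m {b} {b′} {j} {j′} {d} {d′} i (small h₁ h₂ _) h₄ t t′ refl refl refl
    with 0≤x⊎x<0 (+ 2 - (l + m))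
  -- The new l - p s equals δ - m, and δ ≥ -2p, m ≤ 2.
  ... | inj₁ z≤2 = inj₂ (small z≤2 h₁
    (by (lemma Q l m (+ i) (+ j) (+ j′) (isL d) (isL d′) (isM d) (isM d′))
        (h₂ ⊕ 0≤+ {i} ⊕ j+isL+isM≤p q t ⊕ j+isL+isM≤p q t′ ⊕ 0≤isL d ⊕ 0≤isL d′ ⊕ 0≤isM d ⊕ 0≤isM d′)))
    where
      lemma : ∀ q l m i j j′ d₁ d₁′ d₃ d₃′ →
        + 2 - m + i + (1ℤ + q - (j + d₁ + d₃)) + (1ℤ + q - (j′ + d₁′ + d₃′)) + d₁ + d₁′ + d₃ + d₃′ ≡
        (1ℤ + q) * l + q * m + (i - (j + j′)) - (1ℤ + q) * (l + m) + + 2 * (1ℤ + q) + + 2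
      lemma = solve-∀
  -- With l + m ≥ 3 the new reduced L-component is w + (p - 2) + `isM d` + `isM d′`, where w ≥ 0.
  -- The last two cone conditions then have slack p - 4 and p(p - 4) + 2, besides nonnegative terms;
  -- this is where p ≥ 4 enters.
  ... | inj₂ z≥3 = inj₁ (cone
      (by (lemma-s l m (isS d) (isS d′)) (z≥3 ⊕ isS≤1 d ⊕ isS≤1 d′ ⊕ 0≤+ {1}))
      (by (lemma-+ R l s m (+ i) (+ j) (+ j′) (isL d) (isL d′) (isM d) (isM d′)) W)
      (by (lemma-φ R l s m (+ i) (+ j) (+ j′) (isL d) (isL d′) (isM d) (isM d′))
          (0≤+ {suc q} ⊗ W₀ ⊕ 0≤+ {q} ⊗ h₄ ⊕ 0≤+ {suc q} ⊗ 0≤+ {r} ⊕ 0≤+ {2} ⊕ 0≤isM d ⊕ 0≤isM d′)))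
    where
      w : ℤ
      w = (1ℤ + (+ 3 + R)) * (-1ℤ - (+ 2 - (l + m))) + (+ 2 - m) + + i + (P - (+ j + isL d + isM d)) + (P - (+ j′ + isL d′ + isM d′))
      W₀ : 0ℤ ≤ w
      W₀ = 0≤+ {suc q} ⊗ z≥3 ⊕ h₂ ⊕ 0≤+ {i} ⊕ j+isL+isM≤p q t ⊕ j+isL+isM≤p q t′
      W : 0ℤ ≤ w + (+ 2 - - s) + R
      W = W₀ ⊕ h₄ ⊕ 0≤+ {r}
      lemma-s : ∀ l m d d′ → -1ℤ - (+ 2 - (l + m)) + (1ℤ - d) + (1ℤ - d′) + 1ℤ ≡ l + m - (d + d′)
      lemma-s = solve-∀
      lemma-+ : ∀ r l s m i j j′ d₁ d₁′ d₃ d₃′ →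
        (1ℤ + (+ 3 + r)) * (-1ℤ - (+ 2 - (l + m))) + (+ 2 - m) + i +
          (1ℤ + (+ 3 + r) - (j + d₁ + d₃)) + (1ℤ + (+ 3 + r) - (j′ + d₁′ + d₃′)) + (+ 2 - - s) + r ≡
        (1ℤ + (+ 3 + r)) * l + (+ 3 + r) * m + (i - (j + j′)) - (d₁ + d₁′) + (s - (d₃ + d₃′))
      lemma-+ = solve-∀
      lemma-φ : ∀ r l s m i j j′ d₁ d₁′ d₃ d₃′ →
        (1ℤ + (+ 3 + r)) * ((1ℤ + (+ 3 + r)) * (-1ℤ - (+ 2 - (l + m))) + (+ 2 - m) + i +
          (1ℤ + (+ 3 + r) - (j + d₁ + d₃)) + (1ℤ + (+ 3 + r) - (j′ + d₁′ + d₃′))) +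
          (+ 3 + r) * (+ 2 - - s) + (1ℤ + (+ 3 + r)) * r + + 2 + d₃ + d₃′ ≡
        (1ℤ + (+ 3 + r)) * ((1ℤ + (+ 3 + r)) * l + (+ 3 + r) * m + (i - (j + j′)) - (d₁ + d₁′)) +
          (+ 3 + r) * (s - (d₃ + d₃′))
      lemma-φ = solve-∀

  -- If s + m ≥ 4, then m ≤ 2 gives s ≥ 2, and adding p(s - 2) and s + m - 4 to `ps≤` yields l + s +
  -- m - 2 ≥ 0, against the sum being 0.
  Small⇒s+m≤3 : ∀ l s m → Small l s m → l + s + m ≡ 0ℤ → 0ℤ ≤ + 3 - (s + m)
  Small⇒s+m≤3 l s m (small h₁ h₂ h₃) eq with 0≤x⊎x<0 (+ 3 - (s + m))
  ... | inj₁ h = h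
  ... | inj₂ h with by (trans (lemma P l s m) (cong (_+ -[1+ 1 ]) eq)) (h₃ ⊕ 0≤+ {suc q} ⊗ (h ⊕ h₂) ⊕ h)
    where
      lemma : ∀ p l s m →
        l - p * s + + 2 * p + + 2 + p * (-1ℤ - (+ 3 - (s + m)) + (+ 2 - m)) + (-1ℤ - (+ 3 - (s + m))) ≡
        l + s + m + -[1+ 1 ]
      lemma = solve-∀
  ...   | ()

  Bounded : State → Set
  Bounded x@(state l s m _ _ _ _) = Escaped q x ⊎ Small l s m × Small (- l) (- s) (- m)

  Bounded-step : ∀ {x i i′ j j′ c c′ d d′} → Bounded x →
    Step q (State.a x) i c → Step q (State.a′ x) i′ c′ →
    Step q (State.b x) j d → Step q (State.b′ x) j′ d′ →
    Bounded (advance q x (i ℕ.+ i′) c c′ (j ℕ.+ j′) d d′)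
  Bounded-step {x} (inj₁ h) t₁ t₂ t₃ t₄ = inj₁ (Escaped-step q x h t₁ t₂ t₃ t₄)
  Bounded-step {state l s m _ _ _ _} {i} {i′} {j} {j′} (inj₂ (h , h′)) t₁ t₂ t₃ t₄
    with Small-step l s m (i ℕ.+ i′) h (Small.s≤2 h′) t₃ t₄ refl refl refl
       | Small-step (- l) (- s) (- m) (j ℕ.+ j′) h′ (by (lemma s) (Small.s≤2 h)) t₁ t₂
           (neg-l q l m (+ (i ℕ.+ i′)) (+ (j ℕ.+ j′))) (neg-s q l m) refl
    where
      lemma : ∀ s → + 2 - s ≡ + 2 - - - s
      lemma = solve-∀
  ... | inj₁ ahead | _          = inj₁ (inj₁ ahead)
  ... | inj₂ _     | inj₁ ahead = inj₁ (inj₂ ahead)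
  ... | inj₂ h₁    | inj₂ h₂    = inj₂ (h₁ , h₂)

  large-invariant : Invariant q
  large-invariant = record
    { I     = Bounded
    ; init  = inj₂ (zeros , zeros)
    ; step  = λ {x} → Bounded-step {x}
    ; final = λ {x} → final {x}
    }
    where
      zeros : Small 0ℤ 0ℤ 0ℤ
      zeros = small 0≤+ 0≤+ (by (lemma P) (0≤+ {2} ⊗ 0≤+ {suc q} ⊕ 0≤+ {2}))
        where
          lemma : ∀ p → + 2 * p + + 2 ≡ 0ℤ - p * 0ℤ + + 2 * p + + 2
          lemma = solve-∀
      final : ∀ {x} → Bounded x → LetterBounds x
      final {x} (inj₁ h) eq = ⊥-elim (Escaped⇒sum≢0 q x h eq)
      final {state l s m _ _ _ _} (inj₂ (h , h′)) eq =
        -- Since l = -(s + m), the bound 3 on s + m for the vector and its negation bounds l on both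
        -- sides.
        ∣∣≤ 3 l (by upper (Small⇒s+m≤3 (- l) (- s) (- m) h′ (trans (neg-sum l s m) (cong -_ eq))))
                (by lower (Small⇒s+m≤3 l s m h eq)) ,
        ∣∣≤ 2 s (Small.s≤2 h) (by (neg-neg s) (Small.s≤2 h′)) ,
        ∣∣≤ 2 m (Small.m≤2 h) (by (neg-neg m) (Small.m≤2 h′))
        where
          neg-neg : ∀ x → + 2 - - x ≡ + 2 + x
          neg-neg = solve-∀
          neg-sum : ∀ l s m → - l + - s + - m ≡ - (l + s + m)
          neg-sum = solve-∀
          lemma : ∀ l s m → + 3 - (s + m) ≡ + 3 + l - (l + s + m)
          lemma = solve-∀
          lower : + 3 - (s + m) ≡ + 3 + l
          lower = trans (lemma l s m) (trans (cong (λ t → + 3 + l - t) eq) (+-identityʳ _))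
          lemma′ : ∀ l s m → + 3 - (- s + - m) ≡ + 3 - l + (l + s + m)
          lemma′ = solve-∀
          upper : + 3 - (- s + - m) ≡ + 3 - l
          upper = trans (lemma′ l s m) (trans (cong (λ t → + 3 - l + t) eq) (+-identityʳ _))

-- Enumeration, for p = 2 and p = 3

T-∧⁻ : ∀ {x y} → T (x ∧ y) → T x × T y
T-∧⁻ = Equivalence.to T-∧

T-∨⁻ : ∀ {x y} → T (x ∨ y) → T x ⊎ T y
T-∨⁻ = Equivalence.to T-∨

-- Boolean forms of the predicates let the closure check run by evaluation.
aheadᵇ : ℕ → (l s m : ℤ) (b b′ : Letter) → Bool
aheadᵇ q l s m b b′ = coneᵇ (l - (isL b + isL b′)) (s - (isS b + isS b′)) (m - (isM b + isM b′))
  where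
    coneᵇ : ℤ → ℤ → ℤ → Bool
    coneᵇ l s m = (0ℤ ≤ᵇ s) ∧ (0ℤ ≤ᵇ l + m) ∧ (0ℤ ≤ᵇ + suc q * l + + q * m)

aheadᵇ⇒Ahead : ∀ q l s m b b′ → T (aheadᵇ q l s m b b′) → Ahead q l s m b b′
aheadᵇ⇒Ahead q l s m b b′ h with T-∧⁻ h
... | h₁ , h₂₃ with T-∧⁻ h₂₃
...   | h₂ , h₃ = cone (≤ᵇ⇒≤ h₁) (≤ᵇ⇒≤ h₂) (≤ᵇ⇒≤ h₃)

escapedᵇ : ℕ → State → Bool
escapedᵇ q (state l s m a a′ b b′) = aheadᵇ q l s m b b′ ∨ aheadᵇ q (- l) (- s) (- m) a a′

escapedᵇ⇒Escaped : ∀ q x → T (escapedᵇ q x) → Escaped q x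
escapedᵇ⇒Escaped q (state l s m a a′ b b′) h =
  Sum.map (aheadᵇ⇒Ahead q l s m b b′) (aheadᵇ⇒Ahead q (- l) (- s) (- m) a a′) (T-∨⁻ h)

boundedᵇ : State → Bool
boundedᵇ (state l s m _ _ _ _) =
  not ⌊ l + s + m ≟ℤ 0ℤ ⌋ ∨ ((∣ l ∣ ℕ.≤ᵇ 3) ∧ (∣ s ∣ ℕ.≤ᵇ 2) ∧ (∣ m ∣ ℕ.≤ᵇ 2))

boundedᵇ⇒bounded : ∀ x → T (boundedᵇ x) → LetterBounds x
boundedᵇ⇒bounded (state l s m _ _ _ _) h eq with l + s + m ≟ℤ 0ℤ
... | no  ≢0 = ⊥-elim (≢0 eq)
... | yes _ with T-∧⁻ h
...   | h₁ , h₂₃ with T-∧⁻ h₂₃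
...     | h₂ , h₃ = ℕₚ.≤ᵇ⇒≤ _ _ h₁ , ℕₚ.≤ᵇ⇒≤ _ _ h₂ , ℕₚ.≤ᵇ⇒≤ _ _ h₃

next : ℕ → Letter → List (ℕ × Letter)
next q L = map (_, L) (upTo (suc q)) ++ (suc q , S) ∷ []
next q S = (0 , M) ∷ []
next q M = map (_, L) (upTo q) ++ (q , S) ∷ []

next-complete : ∀ {q c j d} → Step q c j d → (j , d) ∈ next q c
next-complete         (L→L j<) = ∈-++⁺ˡ (∈-map⁺ (_, L) (∈-upTo⁺ j<))
next-complete {q = q} L→S      = ∈-++⁺ʳ (map (_, L) (upTo (suc q))) (here refl)
next-complete         S→M      = here refl
next-complete         (M→L j<) = ∈-++⁺ˡ (∈-map⁺ (_, L) (∈-upTo⁺ j<))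
next-complete {q = q} M→S      = ∈-++⁺ʳ (map (_, L) (upTo q)) (here refl)

-- Two endpoints of the same sign are interchangeable, so states are enumerated up to swapping them.
sort : Letter → Letter → Letter × Letter
sort S L = L , S
sort M L = L , M
sort M S = S , M
sort a b = a , b

sort-comm : ∀ a b → sort a b ≡ sort b a
sort-comm L L = refl
sort-comm L S = refl
sort-comm L M = refl
sort-comm S L = refl
sort-comm S S = refl
sort-comm S M = refl
sort-comm M L = refl
sort-comm M S = refl
sort-comm M M = refl

sort-either : ∀ a b → sort a b ≡ (a , b) ⊎ sort a b ≡ (b , a)
sort-either L L = inj₁ refl
sort-either L S = inj₁ refl
sort-either L M = inj₁ refl
sort-either S L = inj₂ refl
sort-either S S = inj₁ refl
sort-either S M = inj₁ refl
sort-either M L = inj₂ refl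
sort-either M S = inj₂ refl
sort-either M M = inj₁ refl

normal : State → State
normal (state l s m a a′ b b′) = let (c , c′) = sort a a′; (d , d′) = sort b b′ in state l s m c c′ d d′

Ahead-sort : ∀ {q} l s m b b′ → Ahead q l s m (proj₁ (sort b b′)) (proj₂ (sort b b′)) → Ahead q l s m b b′
Ahead-sort l s m b b′ h with sort b b′ | sort-either b b′
... | _ | inj₁ refl = h
... | _ | inj₂ refl rewrite +-comm (isL b) (isL b′) | +-comm (isS b) (isS b′) | +-comm (isM b) (isM b′) = h

Escaped-normal : ∀ {q} x → Escaped q (normal x) → Escaped q x
Escaped-normal (state l s m a a′ b b′) = Sum.map (Ahead-sort l s m b b′) (Ahead-sort (- l) (- s) (- m) a a′)

_≟ᵗ_ : (x y : ℕ × Letter × Letter) → Dec (x ≡ y)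
_≟ᵗ_ = ≡-dec ℕₚ._≟_ (≡-dec _≟L_ _≟L_)

-- Many pairs of digits have the same sum and the same unordered pair of following letters; removing
-- duplicates keeps the successor lists short.
nextPair : ℕ → Letter × Letter → List (ℕ × Letter × Letter)
nextPair q (c , c′) =
  deduplicate _≟ᵗ_ (cartesianProductWith (λ (j , d) (j′ , d′) → j ℕ.+ j′ , sort d d′) (next q c) (next q c′))

nextPair-complete : ∀ {q c c′ j j′ d d′} → Step q c j d → Step q c′ j′ d′ →
                    (j ℕ.+ j′ , sort d d′) ∈ nextPair q (sort c c′)
nextPair-complete {q} {c} {c′} {j} {j′} {d} {d′} t t′ with sort c c′ | sort-either c c′
... | _ | inj₁ refl = ∈-deduplicate⁺ _≟ᵗ_ (∈-cartesianProductWith⁺ _ (next-complete t) (next-complete t′))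
... | _ | inj₂ refl rewrite ℕₚ.+-comm j j′ | sort-comm d d′ =
  ∈-deduplicate⁺ _≟ᵗ_ (∈-cartesianProductWith⁺ _ (next-complete t′) (next-complete t))

successors : ℕ → State → List State
successors q x@(state _ _ _ a a′ b b′) =
  cartesianProductWith (λ (i , c , c′) (j , d , d′) → advance q x i c c′ j d d′) (nextPair q (a , a′)) (nextPair q (b , b′))

successors-complete : ∀ {q} x {i i′ j j′ c c′ d d′} →
  Step q (State.a x) i c → Step q (State.a′ x) i′ c′ →
  Step q (State.b x) j d → Step q (State.b′ x) j′ d′ →
  normal (advance q x (i ℕ.+ i′) c c′ (j ℕ.+ j′) d d′) ∈ successors q (normal x)
successors-complete {q} x t₁ t₂ t₃ t₄ =
  ∈-cartesianProductWith⁺ (λ (i , c , c′) (j , d , d′) → advance q (normal x) i c c′ j d d′)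
    (nextPair-complete t₁ t₂) (nextPair-complete t₃ t₄)

_≡ˢ_ : State → State → Bool
state l s m a b c d ≡ˢ state l′ s′ m′ a′ b′ c′ d′ =
  ⌊ l ≟ℤ l′ ⌋ ∧ ⌊ s ≟ℤ s′ ⌋ ∧ ⌊ m ≟ℤ m′ ⌋ ∧ ⌊ a ≟L a′ ⌋ ∧ ⌊ b ≟L b′ ⌋ ∧ ⌊ c ≟L c′ ⌋ ∧ ⌊ d ≟L d′ ⌋

≡ˢ⇒≡ : ∀ x y → T (x ≡ˢ y) → x ≡ y
≡ˢ⇒≡ (state l s m a b c d) (state l′ s′ m′ a′ b′ c′ d′) h
  with h₁ , h ← T-∧⁻ h
  with h₂ , h ← T-∧⁻ h
  with h₃ , h ← T-∧⁻ h
  with h₄ , h ← T-∧⁻ h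
  with h₅ , h ← T-∧⁻ h
  with h₆ , h₇ ← T-∧⁻ h
  with refl ← toWitness {a? = l ≟ℤ l′} h₁
  with refl ← toWitness {a? = s ≟ℤ s′} h₂
  with refl ← toWitness {a? = m ≟ℤ m′} h₃
  with refl ← toWitness {a? = a ≟L a′} h₄
  with refl ← toWitness {a? = b ≟L b′} h₅
  with refl ← toWitness {a? = c ≟L c′} h₆
  with refl ← toWitness {a? = d ≟L d′} h₇ = refl

-- Only guides the search in a tree: a collision could make the check below fail, but
-- not succeed wrongly.
key : State → ℕ
key (state l s m a a′ b b′) =
  code a (code a′ (code b (code b′ (shift l (shift s (shift m 0))))))
  where
    code : Letter → ℕ → ℕ
    code L n = 3 ℕ.* n
    code S n = 1 ℕ.+ 3 ℕ.* n
    code M n = 2 ℕ.+ 3 ℕ.* n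
    shift : ℤ → ℕ → ℕ
    shift x n = ∣ x + + 16 ∣ ℕ.+ 32 ℕ.* n

data Tree : Set where
  leaf : Tree
  node : Tree → ℕ → State → Tree → Tree

member : ℕ → State → Tree → Bool
member k x leaf            = false
member k x (node t k′ y u) =
  if k ≡ᵇ k′ then x ≡ˢ y else (if k <ᵇ k′ then member k x t else member k x u)

insert : ℕ → State → Tree → Tree
insert k x leaf            = node leaf k x leaf
insert k x (node t k′ y u) =
  if k <ᵇ k′ then node (insert k x t) k′ y u else node t k′ y (insert k x u)

allTree : (State → Bool) → Tree → Bool
allTree P leaf           = true
allTree P (node t _ x u) = P x ∧ allTree P t ∧ allTree P u

-- The descent of `member` meets only nodes whose states satisfy `P`, and it succeeds only if `≡ˢ`
-- identifies `x` with such a state.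
allTree-member : ∀ P k x t → T (allTree P t) → T (member k x t) → T (P x)
allTree-member P k x (node t k′ y u) h∀ h with k ≡ᵇ k′
... | true rewrite ≡ˢ⇒≡ x y h = proj₁ (T-∧⁻ {P y} h∀)
... | false with k <ᵇ k′
...   | true  = allTree-member P k x t (proj₁ (T-∧⁻ {allTree P t} (proj₂ (T-∧⁻ {P y} h∀)))) h
...   | false = allTree-member P k x u (proj₂ (T-∧⁻ {allTree P t} (proj₂ (T-∧⁻ {P y} h∀)))) h

-- A worklist search that discards escaped states. Its outcome is trusted only after the check
-- `isClosed`.
explore : ℕ → ℕ → List State → Tree → Tree
explore q zero       _       t = t
explore q (suc fuel) []      t = t
explore q (suc fuel) (x ∷ w) t = add (successors q x) w t
  where
    add : List State → List State → Tree → Tree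
    add []       w t = explore q fuel w t
    add (y ∷ ys) w t =
      if escapedᵇ q y ∨ member (key y) y t then add ys w t
      else add ys (y ∷ w) (insert (key y) y t)

-- Certifies that the states in the tree, together with the escaped ones, form an inductive
-- invariant.
isClosed : ℕ → Tree → Bool
isClosed q t = member (key start) start t ∧
  allTree (λ x → boundedᵇ x ∧ all (λ y → escapedᵇ q y ∨ member (key y) y t) (successors q x)) t

closed-invariant : ∀ q t → T (isClosed q t) → Invariant q
closed-invariant q t closed with T-∧⁻ closed
... | start∈t , h = record
  { I     = I
  ; init  = inj₂ start∈t
  ; step  = λ {x} → step {x}
  ; final = λ {x} → final {x}
  }
  where
    I : State → Set
    I x = Escaped q x ⊎ T (member (key (normal x)) (normal x) t)
    at : ∀ x → T (member (key x) x t) →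
         T (boundedᵇ x) × T (all (λ y → escapedᵇ q y ∨ member (key y) y t) (successors q x))
    at x x∈t = T-∧⁻ (allTree-member _ (key x) x t h x∈t)
    step : ∀ {x i i′ j j′ c c′ d d′} → I x →
      Step q (State.a x) i c → Step q (State.a′ x) i′ c′ →
      Step q (State.b x) j d → Step q (State.b′ x) j′ d′ →
      I (advance q x (i ℕ.+ i′) c c′ (j ℕ.+ j′) d d′)
    step {x} (inj₁ esc) t₁ t₂ t₃ t₄ = inj₁ (Escaped-step q x esc t₁ t₂ t₃ t₄)
    step {x} {i} {i′} {j} {j′} {c} {c′} {d} {d′} (inj₂ x∈t) t₁ t₂ t₃ t₄ =
      Sum.map₁ (λ esc → Escaped-normal y (escapedᵇ⇒Escaped q (normal y) esc))
        (T-∨⁻ {escapedᵇ q (normal y)} (All.lookup (all⁺ _ (successors q (normal x)) (proj₂ (at (normal x) x∈t)))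
          (successors-complete x t₁ t₂ t₃ t₄)))
      where
        y : State
        y = advance q x (i ℕ.+ i′) c c′ (j ℕ.+ j′) d d′
    final : ∀ {x} → I x → LetterBounds x
    final {x} (inj₁ esc) eq = ⊥-elim (Escaped⇒sum≢0 q x esc eq)
    -- Sorting changes the letters only, so the bounds for `normal x` are those for `x`.
    final {x} (inj₂ x∈t) eq = boundedᵇ⇒bounded (normal x) (proj₁ (at (normal x) x∈t)) eq

-- The fuel has to exceed the number of normal states found: 1408 for p = 2, 1336 for p = 3.
reachable : ℕ → ℕ → Tree
reachable q fuel = explore q fuel (start ∷ []) (insert (key start) start leaf)

invariant : ∀ r → Invariant (suc r)
-- `tt` is accepted because `isClosed` evaluates to `true` during type checking; the arguments 1 and
-- 2 are p - 1.
invariant 0             = closed-invariant 1 (reachable 1 1500) tt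
invariant 1             = closed-invariant 2 (reachable 2 1500) tt
invariant (suc (suc r)) = large-invariant r

theorem1 : (p : ℕ) → 1 < p →
    (Balanced 3 L (u p) × Attained 3 L (u p)) ×
    (Balanced 2 S (u p) × Attained 2 S (u p)) ×
    (Balanced 2 M (u p) × Attained 2 M (u p))
theorem1 (suc (suc r)) (s≤s (s≤s z≤n)) with balanced (invariant r) | attained-all r
... | bL , bS , bM | aL , aS , aM = (bL , aL) , (bS , aS) , (bM , aM)
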